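{- For integers $1\leq k\leq n\leq 2k$, let $\hat{B}_{k,n}$ be the set of all $(x_1,\ldots,x_n)\in[0,1]^n$ with $x_{i+1}+\cdots+x_{i+k}\leq1$ for all $0\leq i\leq n-k$. Then \[ E^*(\hat{B}_{k,n},z)=Q_{n-k+1}(z), \] where $Q_m(z)=\sum_{j=1}^m N(m,j)z^{j-1}$ and $N(m,j)=\frac1m\binom mj\binom m{j-1}$ are the Narayana numbers.
   Context: For a lattice polytope $P\subset\mathbb{R}^n$, $E(P,t)=\#(tP\cap\mathbb{Z}^n)$ for integers $t\geq0$ and $E^*(P,z)=(1-z)^{n+1}\sum_{t\geq0}E(P,t)z^t$ is its Ehrhart $h^*$-polynomial. ($\hat{B}_{k,n}$ is a lattice polytope.) -}

module Defs where

open import Data.Bool using (Bool; true; false; _∧_)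
open import Data.Nat using (ℕ; zero; suc; _+_; _*_; _∸_; _≤ᵇ_; _/_)
open import Data.Nat.Combinatorics using (_C_)
open import Data.Integer using (ℤ; +_; _-_)
open import Data.List using (List; []; _∷_; map; concatMap; upTo; take; drop; filterᵇ; length)
open import Function using (_∘_)
open import Data.Nat.ListAction using (sum)
open import Data.List using (all)

box : ℕ → ℕ → List (List ℕ)
box zero    t = [] ∷ []
box (suc n) t = concatMap (λ a → map (a ∷_) (box n t)) (upTo (suc t))

-- x ∈ t·B̂_{k,n} for a lattice point x of the box [0,t]^n:
-- x_{i+1}+⋯+x_{i+k} ≤ t for all 0 ≤ i ≤ n-k.
inDilatedBhat : ℕ → ℕ → ℕ → List ℕ → Bool
inDilatedBhat k n t x = all (λ i → sum (take k (drop i x)) ≤ᵇ t) (upTo (suc (n ∸ k)))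

ehrhartBhat : ℕ → ℕ → ℕ → ℕ
ehrhartBhat k n t = length (filterᵇ (inDilatedBhat k n t) (box n t))

Series : Set
Series = ℕ → ℤ

times1-z : Series → Series
times1-z f zero    = f zero
times1-z f (suc t) = f (suc t) - f t

times1-z^ : ℕ → Series → Series
times1-z^ zero    f = f
times1-z^ (suc m) f = times1-z (times1-z^ m f)

hStarBhat : ℕ → ℕ → Series
hStarBhat k n = times1-z^ (suc n) (λ t → + ehrhartBhat k n t)

-- Narayana numbers N(m,j) = (1/m) C(m,j) C(m,j-1), for m ≥ 1 (m = suc m').
narayana : (m' j : ℕ) → ℕ
narayana m' j = ((suc m' C j) * (suc m' C (j ∸ 1))) / suc m'

-- Coefficient of z^d in Q_m(z) = Σ_{j=1}^m N(m,j) z^{j-1}, for m = suc m'.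
-- (For d ≥ m the binomial C(m,d+1) vanishes, so this is 0.)
Qcoeff : (m' d : ℕ) → ℕ
Qcoeff m' d = narayana m' (suc d)

{-# OPTIONS --safe #-}
module Submission where

-- Put r = n - k ≤ k and split a point of t·B̂ as (a₁,…,a_r, c₁,…,c_{k-r}, b₁,…,b_r).  Each
-- window contains all of c, so every cᵢ only contributes a factor 1/(1-z) to the Ehrhart
-- series.  For the remaining coordinates put s = t - Σcᵢ.  The windows say that
-- b₁+…+bᵢ ≤ s - (a_{i+1}+…+a_r) for all i: the points are pairs of non-crossing lattice
-- paths, and the reflection argument counts them by
--   C(s+r, r)² - C(s+r+1, r+2) C(s+r-1, r-2).
-- The generating function of a product of two such binomials has numerator coefficients
-- C(p, n-d) C(q, d), which here gives C(r, d)² - C(r, d-1) C(r, d+1) = N(r+1, d+1).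

open import Defs
open import Data.Nat using (ℕ; _≤_; _*_; _∸_)
open import Data.Integer using (+_)
open import Relation.Binary.PropositionalEquality using (_≡_)
open import Algebra.Bundles using (AbelianGroup)
open import Algebra.Properties.Group using (∙-cancelʳ)
open import Data.Bool using (Bool; true; false; _∧_; if_then_else_)
open import Data.Bool.ListAction using (all)
import Data.Integer as ℤ
import Data.Integer.Properties as ℤ
import Data.Integer.Tactic.RingSolver as ℤ-Solver
open import Data.List as List using (List; length; take; drop; filterᵇ; concatMap; applyUpTo; upTo)
open import Data.List.Properties using (drop-drop) renaming (++-assoc to List-++-assoc; length-++ to List-length-++)
open import Data.Nat using (zero; suc; _+_; _<_; z≤n; s≤s; _≤ᵇ_; _≤?_; _/_)
open import Data.Nat.Combinatorics using (_C_; nCk+nC[k+1]≡[n+1]C[k+1]; k>n⇒nCk≡0)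
open import Data.Nat.DivMod using (m*n/n≡m)
open import Data.Nat.ListAction using (sum)
open import Data.Nat.ListAction.Properties using (sum-++)
open import Data.Nat.Properties
open import Data.Nat.Tactic.RingSolver using (solve-∀)
open import Data.Vec using (Vec; []; _∷_; toList; _++_)
open import Data.Vec.Properties using (toList-++; length-toList)
open import Relation.Binary.PropositionalEquality using (refl; sym; trans; cong; cong₂; subst; module ≡-Reasoning)
open import Relation.Nullary using (yes; no)
open import Relation.Nullary.Decidable using (dec-true; dec-false)
open ≡-Reasoning

-- Finite sums, binomial coefficients and multiset coefficients.

sum≤ : ℕ → (ℕ → ℕ) → ℕ
sum≤ zero    f = f 0
sum≤ (suc n) f = f 0 + sum≤ n (λ i → f (suc i))

sum≤-cong : ∀ n {f g : ℕ → ℕ} → (∀ i → i ≤ n → f i ≡ g i) → sum≤ n f ≡ sum≤ n g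
sum≤-cong zero    e = e 0 z≤n
sum≤-cong (suc n) e = cong₂ _+_ (e 0 z≤n) (sum≤-cong n λ i i≤n → e (suc i) (s≤s i≤n))

-- Binomial coefficients by Pascal's recursion, so that Pascal's rule holds by computation; `bin≡C`
-- links them to `_C_`.
bin : ℕ → ℕ → ℕ
bin n       zero    = 1
bin zero    (suc k) = 0
bin (suc n) (suc k) = bin n k + bin n (suc k)

bin≡C : ∀ n k → bin n k ≡ n C k
bin≡C n       zero    = refl
bin≡C zero    (suc k) = refl
bin≡C (suc n) (suc k) = trans (cong₂ _+_ (bin≡C n k) (bin≡C n (suc k))) (nCk+nC[k+1]≡[n+1]C[k+1] n k)

n<k⇒bin≡0 : ∀ {n k} → n < k → bin n k ≡ 0
n<k⇒bin≡0 {n} {k} n<k = trans (bin≡C n k) (k>n⇒nCk≡0 n<k)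

-- The absorption identity (k+1) C(n, k+1) = (n-k) C(n, k), with the subtracted term moved to the
-- left to stay in ℕ.
bin-absorb : ∀ n k → suc k * bin n (suc k) + k * bin n k ≡ n * bin n k
bin-absorb zero    zero    = refl
bin-absorb zero    (suc k) = cong₂ _+_ (*-zeroʳ (suc (suc k))) (*-zeroʳ (suc k))
bin-absorb (suc n) zero    = begin
  1 * (1 + bin n 1) + 0            ≡⟨ shuffle (bin n 1) ⟩
  1 + (1 * bin n 1 + 0 * bin n 0)  ≡⟨ cong suc (bin-absorb n 0) ⟩
  suc n * 1                        ∎
  where
  shuffle : ∀ b → 1 * (1 + b) + 0 ≡ 1 + (1 * b + 0 * 1)
  shuffle = solve-∀
bin-absorb (suc n) (suc k) = begin
  suc (suc k) * (b + c) + suc k * (a + b)                          ≡⟨ shuffle k a b c ⟩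
  (suc k * b + k * a) + (suc (suc k) * c + suc k * b) + (a + b)    ≡⟨ cong (_+ (a + b)) (cong₂ _+_ (bin-absorb n k) (bin-absorb n (suc k))) ⟩
  n * a + n * b + (a + b)                                          ≡⟨ collect n a b ⟩
  suc n * (a + b)                                                  ∎
  where
  a = bin n k
  b = bin n (suc k)
  c = bin n (suc (suc k))
  shuffle : ∀ k a b c → suc (suc k) * (b + c) + suc k * (a + b)
                      ≡ (suc k * b + k * a) + (suc (suc k) * c + suc k * b) + (a + b)
  shuffle = solve-∀
  collect : ∀ n a b → n * a + n * b + (a + b) ≡ suc n * (a + b)
  collect = solve-∀

-- H v i = C(v+i-1, i) counts the weakly increasing sequences of length i in v values.
H : ℕ → ℕ → ℕ
H zero    zero    = 1
H zero    (suc i) = 0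
H (suc v) zero    = 1
H (suc v) (suc i) = H v (suc i) + H (suc v) i

H-zeroʳ : ∀ v → H v 0 ≡ 1
H-zeroʳ zero    = refl
H-zeroʳ (suc v) = refl

H-one : ∀ i → H 1 i ≡ 1
H-one zero    = refl
H-one (suc i) = H-one i

H-sym : ∀ v i → H (suc v) i ≡ H (suc i) v
H-sym zero    i       = trans (H-one i) (sym (H-zeroʳ (suc i)))
H-sym (suc v) zero    = sym (H-one (suc v))
H-sym (suc v) (suc i) = begin
  H (suc v) (suc i) + H (suc (suc v)) i  ≡⟨ cong₂ _+_ (H-sym v (suc i)) (H-sym (suc v) i) ⟩
  H (suc (suc i)) v + H (suc i) (suc v)  ≡⟨ +-comm (H (suc (suc i)) v) _ ⟩
  H (suc i) (suc v) + H (suc (suc i)) v  ∎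

-- Pascal's rule with one term reflected by `H-sym`. It closes the path recursion at gap 0, where no
-- smaller gap is left to induct on.
H-add : ∀ w i → H (suc i) w + H w (suc i) ≡ H (suc (suc i)) w
H-add zero    i = refl
H-add (suc w) i = cong (_+_ (H (suc i) (suc w))) (H-sym w (suc i))

H-bin : ∀ v i → H (suc v) i ≡ bin (v + i) i
H-bin v       zero    = refl
H-bin zero    (suc i) = begin
  H 1 i                    ≡⟨ H-bin 0 i ⟩
  bin i i                  ≡⟨ +-identityʳ _ ⟨
  bin i i + 0              ≡⟨ cong (_+_ (bin i i)) (n<k⇒bin≡0 (n<1+n i)) ⟨
  bin i i + bin i (suc i)  ∎
H-bin (suc v) (suc i) = begin
  H (suc v) (suc i) + H (suc (suc v)) i            ≡⟨ cong₂ _+_ (H-bin v (suc i)) (H-bin (suc v) i) ⟩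
  bin (v + suc i) (suc i) + bin (suc v + i) i      ≡⟨ +-comm (bin (v + suc i) (suc i)) _ ⟩
  bin (suc v + i) i + bin (v + suc i) (suc i)      ≡⟨ cong (λ x → bin x i + bin (v + suc i) (suc i)) (+-suc v i) ⟨
  bin (v + suc i) i + bin (v + suc i) (suc i)      ∎

-- Pairs of non-crossing lattice paths and their determinant formula.

δ : ℕ → ℕ → ℕ
δ zero    zero    = 1
δ zero    (suc n) = 0
δ (suc m) zero    = 0
δ (suc m) (suc n) = δ m n

antidiag : (ℕ → ℕ → ℕ) → ℕ → ℕ → ℕ
antidiag φ D w = sum≤ w (λ a → φ (D + a) (w ∸ a))

antidiag-zero : ∀ φ D → antidiag φ D 0 ≡ φ D 0
antidiag-zero φ D = cong (λ x → φ x 0) (+-identityʳ D)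

-- Either the step `a` is 0, or one unit of it is moved from `w` into the gap, which keeps D + w
-- fixed. The determinant formulas follow by induction along this recursion.
antidiag-suc : ∀ φ D w → antidiag φ D (suc w) ≡ φ D (suc w) + antidiag φ (suc D) w
antidiag-suc φ D w = cong₂ _+_ (cong (λ x → φ x (suc w)) (+-identityʳ D))
  (sum≤-cong w λ a _ → cong (λ x → φ x (w ∸ a)) (+-suc D a))

-- pairs r D w counts the pairs of step sequences (a₁,…,a_r), (b₁,…,b_r) with Σaᵢ = w for
-- which a gap that starts at D and is raised by a₁, lowered by b₁, raised by a₂, … never
-- becomes negative; pairs-b does the same when the gap is first lowered by an extra b₀.
mutual
  pairs : ℕ → ℕ → ℕ → ℕ
  pairs zero    D w = δ 0 w
  pairs (suc r) D w = antidiag (pairs-b r) D w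

  pairs-b : ℕ → ℕ → ℕ → ℕ
  pairs-b r D w = sum≤ D (λ b → pairs r (D ∸ b) w)

-- The right-hand sides count all pairs of paths, the products on the left the crossing ones.
mutual
  pairs-det : ∀ r D w → pairs (suc r) D w + H w (2 + r) * H r (suc (D + w)) ≡ H (suc r) w * H (2 + r) (D + w)
  pairs-det r D zero = begin
    pairs (suc r) D 0 + 0                        ≡⟨ +-identityʳ _ ⟩
    pairs (suc r) D 0                            ≡⟨ antidiag-zero (pairs-b r) D ⟩
    pairs-b r D 0                                ≡⟨ +-identityʳ _ ⟨
    pairs-b r D 0 + 0                            ≡⟨ pairs-b-det r D 0 ⟩
    H r 0 * H (2 + r) (D + 0)                    ≡⟨ cong (_* H (2 + r) (D + 0)) (H-zeroʳ r) ⟩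
    1 * H (2 + r) (D + 0)                        ∎
  -- Both parts of the recursion have the same D + w, so the two induction hypotheses share the
  -- second factor of each product, and Pascal's rule adds the first factors.
  pairs-det r D (suc w) = begin
    pairs (suc r) D (suc w) + (A + A′) * H r (suc (D + suc w))
      ≡⟨ cong₂ (λ x y → x + (A + A′) * H r (suc y)) (antidiag-suc (pairs-b r) D w) (+-suc D w) ⟩
    pairs-b r D (suc w) + pairs (suc r) (suc D) w + (A + A′) * H r (2 + (D + w))
      ≡⟨ shuffle (pairs-b r D (suc w)) (pairs (suc r) (suc D) w) A A′ (H r (2 + (D + w))) ⟩
    pairs-b r D (suc w) + A′ * H r (2 + (D + w)) + (pairs (suc r) (suc D) w + A * H r (2 + (D + w)))
      ≡⟨ cong₂ (λ x y → pairs-b r D (suc w) + A′ * H r (suc x) + y) (sym (+-suc D w)) (pairs-det r (suc D) w) ⟩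
    pairs-b r D (suc w) + A′ * H r (suc (D + suc w)) + H (suc r) w * H (2 + r) (suc (D + w))
      ≡⟨ cong₂ (λ x y → x + H (suc r) w * H (2 + r) y) (pairs-b-det r D (suc w)) (sym (+-suc D w)) ⟩
    H r (suc w) * H (2 + r) (D + suc w) + H (suc r) w * H (2 + r) (D + suc w)
      ≡⟨ *-distribʳ-+ (H (2 + r) (D + suc w)) (H r (suc w)) (H (suc r) w) ⟨
    H (suc r) (suc w) * H (2 + r) (D + suc w) ∎
    where
    A = H w (2 + r)
    A′ = H (suc w) (suc r)
    shuffle : ∀ g f a a′ b → g + f + (a + a′) * b ≡ g + a′ * b + (f + a * b)
    shuffle = solve-∀

  pairs-b-det : ∀ r D w → pairs-b r D w + H w (suc r) * H r (suc (D + w)) ≡ H r w * H (2 + r) (D + w)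
  pairs-b-det zero D zero = begin
    pairs-b 0 D 0 + 0      ≡⟨ +-identityʳ _ ⟩
    pairs-b 0 D 0          ≡⟨ ones D ⟩
    suc D                  ≡⟨ count D ⟨
    H 2 D                  ≡⟨ cong (H 2) (+-identityʳ D) ⟨
    H 2 (D + 0)            ≡⟨ +-identityʳ _ ⟨
    H 2 (D + 0) + 0        ∎
    where
    ones : ∀ D → pairs-b 0 D 0 ≡ suc D
    ones zero    = refl
    ones (suc D) = cong suc (ones D)
    count : ∀ D → H 2 D ≡ suc D
    count zero    = refl
    count (suc D) = cong₂ _+_ (H-one D) (count D)
  pairs-b-det zero D (suc w) = cong₂ _+_ (zeros D) (*-zeroʳ (H (suc w) 1))
    where
    zeros : ∀ D → pairs-b 0 D (suc w) ≡ 0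
    zeros zero    = refl
    zeros (suc D) = zeros D
  -- Gap 0 forces b₀ = 0. Compared with `pairs-det r 0 w`, both sides grow by `H (suc r) w * A`, on
  -- the right because of `H-add`.
  pairs-b-det (suc r) zero w = begin
    f + A * (H r (suc w) + H (suc r) w)           ≡⟨ shuffle f A (H r (suc w)) (H (suc r) w) ⟩
    f + A * H r (suc w) + H (suc r) w * A         ≡⟨ cong (_+ H (suc r) w * A) (pairs-det r 0 w) ⟩
    H (suc r) w * H (2 + r) w + H (suc r) w * A   ≡⟨ *-distribˡ-+ (H (suc r) w) (H (2 + r) w) A ⟨
    H (suc r) w * (H (2 + r) w + A)               ≡⟨ cong (H (suc r) w *_) (H-add w (suc r)) ⟩
    H (suc r) w * H (3 + r) w                     ∎
    where
    f = pairs (suc r) 0 w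
    A = H w (2 + r)
    shuffle : ∀ f a b c → f + a * (b + c) ≡ f + a * b + c * a
    shuffle = solve-∀
  -- The split is by b₀ = 0 or b₀ > 0. Here the first factors `A` and `E` are shared, and Pascal's
  -- rule adds the second ones.
  pairs-b-det (suc r) (suc D) w = begin
    f + g + A * (B + B′)             ≡⟨ shuffle f g A B B′ ⟩
    f + A * B + (g + A * B′)         ≡⟨ cong₂ _+_ (pairs-det r (suc D) w) (pairs-b-det (suc r) D w) ⟩
    E * K + E * K′                   ≡⟨ *-distribˡ-+ E K K′ ⟨
    E * (K + K′)                     ∎
    where
    f = pairs (suc r) (suc D) w
    g = pairs-b (suc r) D w
    A = H w (2 + r)
    B = H r (2 + (D + w))
    B′ = H (suc r) (suc (D + w))
    E = H (suc r) w
    K = H (2 + r) (suc (D + w))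
    K′ = H (3 + r) (D + w)
    shuffle : ∀ f g a b b′ → f + g + a * (b + b′) ≡ f + a * b + (g + a * b′)
    shuffle = solve-∀

-- Sums `pairs-det` over the starting gap, by the same induction. At D = 0, with R = r + 1 and s =
-- w, it gives the count C(s+R, R)² - C(s+R+1, R+2) C(s+R-1, R-2).
antidiag-det : ∀ r D w → antidiag (pairs (suc r)) D w + H w (3 + r) * H r (suc (D + w))
                       ≡ H (2 + r) w * H (2 + r) (D + w)
antidiag-det r D zero = begin
  antidiag (pairs (suc r)) D 0 + 0  ≡⟨ cong (_+ 0) (antidiag-zero (pairs (suc r)) D) ⟩
  pairs (suc r) D 0 + 0             ≡⟨ pairs-det r D 0 ⟩
  1 * H (2 + r) (D + 0)             ∎
antidiag-det r D (suc w) = begin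
  antidiag (pairs (suc r)) D (suc w) + (A + A′) * H r (suc (D + suc w))
    ≡⟨ cong (_+ (A + A′) * H r (suc (D + suc w))) (antidiag-suc (pairs (suc r)) D w) ⟩
  f + h + (A + A′) * H r (suc (D + suc w))
    ≡⟨ shuffle f h A A′ (H r (suc (D + suc w))) ⟩
  f + A′ * H r (suc (D + suc w)) + (h + A * H r (suc (D + suc w)))
    ≡⟨ cong₂ (λ x y → x + (h + A * H r (suc y))) (pairs-det r D (suc w)) (+-suc D w) ⟩
  H (suc r) (suc w) * H (2 + r) (D + suc w) + (h + A * H r (2 + (D + w)))
    ≡⟨ cong (_+_ (H (suc r) (suc w) * H (2 + r) (D + suc w))) (antidiag-det r (suc D) w) ⟩
  H (suc r) (suc w) * H (2 + r) (D + suc w) + H (2 + r) w * H (2 + r) (suc (D + w))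
    ≡⟨ cong (λ x → H (suc r) (suc w) * H (2 + r) (D + suc w) + H (2 + r) w * H (2 + r) x) (+-suc D w) ⟨
  H (suc r) (suc w) * H (2 + r) (D + suc w) + H (2 + r) w * H (2 + r) (D + suc w)
    ≡⟨ *-distribʳ-+ (H (2 + r) (D + suc w)) (H (suc r) (suc w)) (H (2 + r) w) ⟨
  H (2 + r) (suc w) * H (2 + r) (D + suc w) ∎
  where
  f = pairs (suc r) D (suc w)
  h = antidiag (pairs (suc r)) (suc D) w
  A = H w (3 + r)
  A′ = H (suc w) (2 + r)
  shuffle : ∀ f h a a′ b → f + h + (a + a′) * b ≡ f + a′ * b + (h + a * b)
  shuffle = solve-∀

-- Narayana numbers as differences of products of binomials.

-- C(n, k - d), which is 0 when d > k.
bin∸ : ℕ → ℕ → ℕ → ℕ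
bin∸ n k       zero    = bin n k
bin∸ n zero    (suc d) = 0
bin∸ n (suc k) (suc d) = bin∸ n k d

-- Pascal's rule survives at the boundary d = k + 1 because `bin∸` is 0 for d > k; a truncated k ∸ d
-- would give 1 there.
bin∸-pascal : ∀ n k d → bin∸ (suc n) (suc k) d ≡ bin∸ n (suc k) d + bin∸ n k d
bin∸-pascal n k       zero          = +-comm (bin n k) _
bin∸-pascal n zero    (suc zero)    = refl
bin∸-pascal n zero    (suc (suc d)) = refl
bin∸-pascal n (suc k) (suc d)       = bin∸-pascal n k d

-- The symmetry of binomial coefficients, by Pascal's rule on both sides.
bin∸-diag : ∀ n d → bin∸ n n d ≡ bin n d
bin∸-diag n       zero    = trans (sym (H-bin 0 n)) (H-one n)
bin∸-diag zero    (suc d) = refl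
bin∸-diag (suc n) (suc d) = begin
  bin∸ (suc n) n d                      ≡⟨ bin∸-pascal n n (suc d) ⟩
  bin∸ n n d + bin∸ n n (suc d)         ≡⟨ cong₂ _+_ (bin∸-diag n d) (bin∸-diag n (suc d)) ⟩
  bin n d + bin n (suc d)               ∎

-- This is N(r+1, d+1) = C(r, d)² - C(r, d-1) C(r, d+1), multiplied by r + 1 and freed of
-- subtraction. The factor `bin∸ r (suc r) d` is C(r, d-1), with the correct value 0 at d = 0.
narayana-det : ∀ r d → (bin (suc r) (suc d) * bin (suc r) d) + suc r * (bin∸ r (suc r) d * bin r (suc d))
             ≡ suc r * (bin r d * bin r d)
narayana-det r zero = begin
  (1 + bin r 1) * 1 + suc r * (bin r (suc r) * bin r 1)
    ≡⟨ cong (λ x → (1 + bin r 1) * 1 + suc r * (x * bin r 1)) (n<k⇒bin≡0 (n<1+n r)) ⟩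
  (1 + bin r 1) * 1 + suc r * 0    ≡⟨ shuffle r (bin r 1) ⟩
  1 + (1 * bin r 1 + 0 * 1)        ≡⟨ cong suc (bin-absorb r 0) ⟩
  suc r * 1                        ∎
  where
  shuffle : ∀ r b → (1 + b) * 1 + suc r * 0 ≡ 1 + (1 * b + 0 * 1)
  shuffle = solve-∀
narayana-det r (suc d) = begin
  (b + c) * (a + b) + suc r * (bin∸ r r d * c)
    ≡⟨ cong (λ x → (b + c) * (a + b) + suc r * (x * c)) (bin∸-diag r d) ⟩
  (b + c) * (a + b) + suc r * (a * c)
    ≡⟨ +-cancelʳ-≡ (X a b c d) _ _ (sym cancelled) ⟩
  suc r * (b * b) ∎
  where
  a = bin r d
  b = bin r (suc d)
  c = bin r (suc (suc d))
  X : ℕ → ℕ → ℕ → ℕ → ℕ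
  -- Padding added to both sides, so that the subtraction-free `bin-absorb` can be applied back and
  -- forth; it is cancelled at the end.
  X a b c d = d * (a * b) + d * (a * c) + suc d * (a * b)
  expand : ∀ a b c d r → suc r * (b * b) + (d * (a * b) + d * (a * c) + suc d * (a * b))
         ≡ b * b + (r * b) * b + (d * (a * b) + d * (a * c) + suc d * (a * b))
  expand = solve-∀
  regroup₁ : ∀ a b c d → b * b + (suc (suc d) * c + suc d * b) * b + (d * (a * b) + d * (a * c) + suc d * (a * b))
           ≡ b * b + suc (suc d) * (c * b) + (suc d * b + d * a) * b + d * (a * c) + suc d * (a * b)
  regroup₁ = solve-∀
  regroup₂ : ∀ a b c d r → b * b + suc (suc d) * (c * b) + (r * a) * b + d * (a * c) + suc d * (a * b)
           ≡ b * b + b * c + (suc d * b + d * a) * c + (r * b) * a + suc d * (a * b)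
  regroup₂ = solve-∀
  contract : ∀ a b c d r → b * b + b * c + (r * a) * c + (suc (suc d) * c + suc d * b) * a + suc d * (a * b)
           ≡ (b + c) * (a + b) + suc r * (a * c) + (d * (a * b) + d * (a * c) + suc d * (a * b))
  contract = solve-∀
  cancelled : suc r * (b * b) + X a b c d ≡ (b + c) * (a + b) + suc r * (a * c) + X a b c d
  cancelled = begin
    suc r * (b * b) + X a b c d
      ≡⟨ expand a b c d r ⟩
    b * b + (r * b) * b + X a b c d
      ≡⟨ cong (λ y → b * b + y * b + X a b c d) (bin-absorb r (suc d)) ⟨
    b * b + (suc (suc d) * c + suc d * b) * b + X a b c d
      ≡⟨ regroup₁ a b c d ⟩
    b * b + suc (suc d) * (c * b) + (suc d * b + d * a) * b + d * (a * c) + suc d * (a * b)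
      ≡⟨ cong (λ y → b * b + suc (suc d) * (c * b) + y * b + d * (a * c) + suc d * (a * b)) (bin-absorb r d) ⟩
    b * b + suc (suc d) * (c * b) + (r * a) * b + d * (a * c) + suc d * (a * b)
      ≡⟨ regroup₂ a b c d r ⟩
    b * b + b * c + (suc d * b + d * a) * c + (r * b) * a + suc d * (a * b)
      ≡⟨ cong₂ (λ x y → b * b + b * c + x * c + y * a + suc d * (a * b)) (bin-absorb r d) (sym (bin-absorb r (suc d))) ⟩
    b * b + b * c + (r * a) * c + (suc (suc d) * c + suc d * b) * a + suc d * (a * b)
      ≡⟨ contract a b c d r ⟩
    (b + c) * (a + b) + suc r * (a * c) + X a b c d ∎

-- Sums with Kronecker deltas and sums over a box.

sum≤-zero : ∀ n {f : ℕ → ℕ} → (∀ i → f i ≡ 0) → sum≤ n f ≡ 0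
sum≤-zero zero    e = e 0
sum≤-zero (suc n) e = cong₂ _+_ (e 0) (sum≤-zero n λ i → e (suc i))

sum≤-+ : ∀ n (f g : ℕ → ℕ) → sum≤ n (λ i → f i + g i) ≡ sum≤ n f + sum≤ n g
sum≤-+ zero    f g = refl
sum≤-+ (suc n) f g = trans (cong (_+_ (f 0 + g 0)) (sum≤-+ n _ _)) (shuffle (f 0) (g 0) _ _)
  where
  shuffle : ∀ a b c d → a + b + (c + d) ≡ a + c + (b + d)
  shuffle = solve-∀

sum≤-swap : ∀ m n (f : ℕ → ℕ → ℕ) → sum≤ m (λ i → sum≤ n (f i)) ≡ sum≤ n (λ j → sum≤ m (λ i → f i j))
sum≤-swap zero    n f = refl
sum≤-swap (suc m) n f = trans (cong (_+_ (sum≤ n (f 0))) (sum≤-swap m n _)) (sym (sum≤-+ n _ _))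

*-sum≤ : ∀ c n (f : ℕ → ℕ) → sum≤ n (λ i → c * f i) ≡ c * sum≤ n f
*-sum≤ c zero    f = refl
*-sum≤ c (suc n) f = trans (cong (_+_ (c * f 0)) (*-sum≤ c n _)) (sym (*-distribˡ-+ c (f 0) _))

-- Box coordinates range up to `t`, while the path sums have shorter ranges; the terms in between
-- vanish by a delta or a failed inequality.
sum≤-truncate : ∀ {u t} {f g : ℕ → ℕ} → u ≤ t → (∀ i → i ≤ u → f i ≡ g i) → (∀ i → u < i → f i ≡ 0) →
                sum≤ t f ≡ sum≤ u g
sum≤-truncate {t = zero}  z≤n eq van = eq 0 z≤n
sum≤-truncate {t = suc t} z≤n eq van = trans (cong₂ _+_ (eq 0 z≤n) (sum≤-zero t λ i → van (suc i) (s≤s z≤n))) (+-identityʳ _)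
sum≤-truncate (s≤s u≤t) eq van = cong₂ _+_ (eq 0 z≤n)
  (sum≤-truncate u≤t (λ i i≤u → eq (suc i) (s≤s i≤u)) (λ i u<i → van (suc i) (s≤s u<i)))

δ-< : ∀ {m n} → n < m → δ m n ≡ 0
δ-< {n = zero}  (s≤s _)   = refl
δ-< {n = suc n} (s≤s n<m) = δ-< n<m

δ-∸ : ∀ c x {u} → c ≤ u → δ (c + x) u ≡ δ x (u ∸ c)
δ-∸ zero    x z≤n       = refl
δ-∸ (suc c) x (s≤s c≤u) = δ-∸ c x c≤u

-- The delta selects the single index s = s₀, and `s₀ ≤ t` places it in the range of summation.
δ-sum≤ : ∀ {t} c s₀ (f : ℕ → ℕ) → s₀ ≤ t → sum≤ t (λ s → δ (c + s) (c + s₀) * f s) ≡ f s₀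
δ-sum≤ (suc c) s₀ f s₀≤t = δ-sum≤ c s₀ f s₀≤t
δ-sum≤ {zero}  zero zero     f z≤n = +-identityʳ (f 0)
δ-sum≤ {suc t} zero zero     f z≤n = trans (cong (_+_ (f 0 + 0)) (sum≤-zero t λ _ → refl)) (trans (+-identityʳ _) (+-identityʳ _))
δ-sum≤ {suc t} zero (suc s₀) f (s≤s s₀≤t) = δ-sum≤ 0 s₀ (λ s → f (suc s)) s₀≤t

δ-sum≤-zero : ∀ t c u (f : ℕ → ℕ) → u < c → sum≤ t (λ s → δ (c + s) u * f s) ≡ 0
δ-sum≤-zero t c u f u<c = sum≤-zero t λ s → cong (_* f s) (δ-< (≤-trans u<c (m≤m+n c s)))

boxSum : ℕ → (n : ℕ) → (Vec ℕ n → ℕ) → ℕ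
boxSum t zero    φ = φ []
boxSum t (suc n) φ = sum≤ t (λ a → boxSum t n (λ x → φ (a ∷ x)))

boxSum-cong : ∀ t n {φ ψ : Vec ℕ n → ℕ} → (∀ x → φ x ≡ ψ x) → boxSum t n φ ≡ boxSum t n ψ
boxSum-cong t zero    e = e []
boxSum-cong t (suc n) e = sum≤-cong t λ a _ → boxSum-cong t n λ x → e (a ∷ x)

boxSum-zero : ∀ t n {φ : Vec ℕ n → ℕ} → (∀ x → φ x ≡ 0) → boxSum t n φ ≡ 0
boxSum-zero t zero    e = e []
boxSum-zero t (suc n) e = sum≤-zero t λ a → boxSum-zero t n λ x → e (a ∷ x)

*-boxSum : ∀ c t n (φ : Vec ℕ n → ℕ) → boxSum t n (λ x → c * φ x) ≡ c * boxSum t n φ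
*-boxSum c t zero    φ = refl
*-boxSum c t (suc n) φ = trans (sum≤-cong t λ a _ → *-boxSum c t n _) (*-sum≤ c t _)

boxSum-sum≤-swap : ∀ t n m (φ : Vec ℕ n → ℕ → ℕ) →
                   boxSum t n (λ x → sum≤ m (φ x)) ≡ sum≤ m (λ i → boxSum t n (λ x → φ x i))
boxSum-sum≤-swap t zero    m φ = refl
boxSum-sum≤-swap t (suc n) m φ = trans (sum≤-cong t λ a _ → boxSum-sum≤-swap t n m _) (sum≤-swap t m _)

boxSum-swap : ∀ t m n (φ : Vec ℕ m → Vec ℕ n → ℕ) →
              boxSum t m (λ x → boxSum t n (φ x)) ≡ boxSum t n (λ y → boxSum t m (λ x → φ x y))
boxSum-swap t m zero    φ = refl
boxSum-swap t m (suc n) φ = trans (boxSum-sum≤-swap t m t _) (sum≤-cong t λ a _ → boxSum-swap t m n _)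

boxSum-++ : ∀ t m n (φ : Vec ℕ (m + n) → ℕ) →
            boxSum t (m + n) φ ≡ boxSum t m (λ x → boxSum t n (λ y → φ (x ++ y)))
boxSum-++ t zero    n φ = refl
boxSum-++ t (suc m) n φ = sum≤-cong t λ a _ → boxSum-++ t m n _

-- Lattice point counts as box sums of indicators.

⟦_⟧ : Bool → ℕ
⟦ b ⟧ = if b then 1 else 0

count : ∀ {A : Set} → (A → Bool) → List A → ℕ
count p xs = length (filterᵇ p xs)

count-++ : ∀ {A : Set} (p : A → Bool) xs ys → count p (xs List.++ ys) ≡ count p xs + count p ys
count-++ p List.[]       ys = refl
count-++ p (x List.∷ xs) ys with p x
... | true  = cong suc (count-++ p xs ys)
... | false = count-++ p xs ys

count-map : ∀ {A B : Set} (p : B → Bool) (f : A → B) xs → count p (List.map f xs) ≡ count (λ x → p (f x)) xs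
count-map p f List.[]       = refl
count-map p f (x List.∷ xs) with p (f x)
... | true  = cong suc (count-map p f xs)
... | false = count-map p f xs

count-concatMap : ∀ {A : Set} (p : A → Bool) (g : ℕ → List A) h t →
                  count p (concatMap g (applyUpTo h (suc t))) ≡ sum≤ t (λ a → count p (g (h a)))
count-concatMap p g h zero    = trans (count-++ p (g (h 0)) List.[]) (+-identityʳ _)
count-concatMap p g h (suc t) = trans (count-++ p (g (h 0)) _)
  (cong (_+_ (count p (g (h 0)))) (count-concatMap p g (λ i → h (suc i)) t))

count-box : ∀ t n (p : List ℕ → Bool) → count p (box n t) ≡ boxSum t n (λ x → ⟦ p (toList x) ⟧)
count-box t zero    p with p List.[]
... | true  = refl
... | false = refl
count-box t (suc n) p = trans (count-concatMap p (λ a → List.map (a List.∷_) (box n t)) (λ a → a) t)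
  (sum≤-cong t λ a _ → trans (count-map p (a List.∷_) (box n t)) (count-box t n (λ x → p (a List.∷ x))))

-- From the window inequalities to the gap condition.

windows : ℕ → ℕ → ℕ → List ℕ → Bool
windows k t zero    x = true
windows k t (suc r) x = (sum (take k x) ≤ᵇ t) ∧ windows k t r (drop 1 x)

-- The index function `h` is general because `upTo` unfolds to `applyUpTo` with a function that
-- shifts at each step, while `y` loses one entry.
all-windows : ∀ k t r x y (h : ℕ → ℕ) → (∀ i → drop (h i) x ≡ drop i y) →
              all (λ i → sum (take k (drop i x)) ≤ᵇ t) (applyUpTo h r) ≡ windows k t r y
all-windows k t zero    x y h e = refl
all-windows k t (suc r) x y h e = cong₂ _∧_ (cong (λ z → sum (take k z) ≤ᵇ t) (e 0))
  (all-windows k t r x (drop 1 y) (λ i → h (suc i)) λ i → trans (e (suc i)) (sym (drop-drop 1 i y)))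

-- The gap condition counted by `pairs`, as a test on one given pair of step sequences.
stays : ∀ {r} → ℕ → Vec ℕ r → Vec ℕ r → Bool
stays D []      []      = true
stays D (a ∷ x) (b ∷ y) = (b ≤ᵇ D + a) ∧ stays (D + a ∸ b) x y

≤ᵇ-true : ∀ {m n} → m ≤ n → (m ≤ᵇ n) ≡ true
≤ᵇ-true {m} {n} = dec-true (m ≤? n)

≤ᵇ-false : ∀ {m n} → n < m → (m ≤ᵇ n) ≡ false
≤ᵇ-false {m} {n} n<m = dec-false (m ≤? n) (<⇒≱ n<m)

take-prefix : ∀ {A : Set} (xs ys : List A) → take (length xs) (xs List.++ ys) ≡ xs
take-prefix List.[]       ys = refl
take-prefix (x List.∷ xs) ys = cong (x List.∷_) (take-prefix xs ys)

first-window : ∀ {r k} (a : Vec ℕ r) (c z : List ℕ) → r + length c ≡ k →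
               sum (take k (toList a List.++ (c List.++ z))) ≡ sum (toList a) + sum c
first-window {r} a c z refl = begin
  sum (take (r + length c) (toList a List.++ (c List.++ z)))
    ≡⟨ cong₂ (λ m l → sum (take m l)) len (sym (List-++-assoc (toList a) c z)) ⟩
  sum (take (length (toList a List.++ c)) ((toList a List.++ c) List.++ z))
    ≡⟨ cong sum (take-prefix (toList a List.++ c) z) ⟩
  sum (toList a List.++ c)
    ≡⟨ sum-++ (toList a) c ⟩
  sum (toList a) + sum c ∎
  where
  len : r + length c ≡ length (toList a List.++ c)
  len = sym (trans (List-length-++ (toList a)) (cong (_+ length c) (length-toList a)))

windows-false : ∀ {r k t} q (a : Vec ℕ r) (c z : List ℕ) → r + length c ≡ k → t < sum (toList a) + sum c →
                windows k t (suc q) (toList a List.++ (c List.++ z)) ≡ false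
windows-false {t = t} q a c z e t< rewrite first-window a c z e | ≤ᵇ-false t< = refl

snoc-sum : ∀ c b → sum (c List.++ b List.∷ List.[]) ≡ sum c + b
snoc-sum c b = trans (sum-++ c (b List.∷ List.[])) (cong (_+_ (sum c)) (+-identityʳ b))

-- `D` is the slack of the first window, which covers exactly `a` and `c`. Sliding the window by one
-- loses the head of `a` and gains the head of `b`, so the slack becomes D + a - b. The new entry is
-- appended to `c`, which restores the window length.
windows-stays : ∀ {r k t} D (a b : Vec ℕ r) (c : List ℕ) → r + length c ≡ k → sum (toList a) + sum c + D ≡ t →
                windows k t (suc r) (toList a List.++ (c List.++ toList b)) ≡ stays D a b
windows-stays D [] [] c e refl
  rewrite first-window [] c List.[] e | ≤ᵇ-true (m≤m+n (sum c) D) = refl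
windows-stays {suc r} {k} {t} D (a ∷ x) (b ∷ y) c e eq
  rewrite first-window (a ∷ x) c (toList (b ∷ y)) e
        | ≤ᵇ-true (≤-trans (m≤m+n (a + sum (toList x) + sum c) D) (≤-reflexive eq))
        | sym (List-++-assoc c (b List.∷ List.[]) (toList y))
  with b ≤? D + a
... | yes b≤ = trans (windows-stays (D + a ∸ b) x y (c List.++ b List.∷ List.[]) len total)
                     (cong (_∧ stays (D + a ∸ b) x y) (sym (≤ᵇ-true b≤)))
  where
  len : r + length (c List.++ b List.∷ List.[]) ≡ k
  len = trans (cong (_+_ r) (trans (List-length-++ c) (+-comm (length c) 1))) (trans (+-suc r (length c)) e)
  shuffle : ∀ X c b g → X + (c + b) + g ≡ X + c + (b + g)
  shuffle = solve-∀
  shuffle′ : ∀ X c D a → X + c + (D + a) ≡ a + X + c + D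
  shuffle′ = solve-∀
  total : sum (toList x) + sum (c List.++ b List.∷ List.[]) + (D + a ∸ b) ≡ t
  total = begin
    X + sum (c List.++ b List.∷ List.[]) + (D + a ∸ b)   ≡⟨ cong (λ s → X + s + (D + a ∸ b)) (snoc-sum c b) ⟩
    X + (sum c + b) + (D + a ∸ b)                        ≡⟨ shuffle X (sum c) b (D + a ∸ b) ⟩
    X + sum c + (b + (D + a ∸ b))                        ≡⟨ cong (_+_ (X + sum c)) (m+[n∸m]≡n b≤) ⟩
    X + sum c + (D + a)                                  ≡⟨ shuffle′ X (sum c) D a ⟩
    a + X + sum c + D                                    ≡⟨ eq ⟩
    t                                                    ∎
    where X = sum (toList x)
-- The next window already sums to more than `t`, so both tests fail.
... | no b≰ = trans (windows-false r x (c List.++ b List.∷ List.[]) (toList y) len large)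
                    (cong (_∧ stays (D + a ∸ b) x y) (sym (≤ᵇ-false (≰⇒> b≰))))
  where
  len : r + length (c List.++ b List.∷ List.[]) ≡ k
  len = trans (cong (_+_ r) (trans (List-length-++ c) (+-comm (length c) 1))) (trans (+-suc r (length c)) e)
  shuffle : ∀ X c D a → X + c + (D + a) ≡ a + X + c + D
  shuffle = solve-∀
  large : t < sum (toList x) + sum (c List.++ b List.∷ List.[])
  large rewrite snoc-sum c b | sym (+-assoc (sum (toList x)) (sum c) b)
              | sym eq | sym (shuffle (sum (toList x)) (sum c) D a) =
    +-monoʳ-< (sum (toList x) + sum c) (≰⇒> b≰)

-- The slacks s = t - Σc and D = s - Σa become summation variables pinned by deltas, which lets the
-- sums over `a`, `b` and `c` be separated. If Σc > t or Σa > s, no index satisfies the deltas and a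
-- window fails.
windows-convolution : ∀ {r} j t (a : Vec ℕ r) (c : Vec ℕ j) (b : Vec ℕ r) →
  ⟦ windows (r + j) t (suc r) (toList a List.++ (toList c List.++ toList b)) ⟧
  ≡ sum≤ t (λ s → δ (sum (toList c) + s) t * sum≤ t (λ D → δ (sum (toList a) + D) s * ⟦ stays D a b ⟧))
windows-convolution {r} j t a c b with sum (toList c) ≤? t
... | no c≰ = trans
  (cong ⟦_⟧ (windows-false r a (toList c) (toList b) (cong (_+_ r) (length-toList c)) (≤-trans (≰⇒> c≰) (m≤n+m Σc Σa))))
  (sym (δ-sum≤-zero t Σc t _ (≰⇒> c≰)))
  where
  Σa = sum (toList a)
  Σc = sum (toList c)
-- With s = t - Σc as a variable, `t` can be replaced by Σc + s throughout.
... | yes c≤ = helper (t ∸ Σc) (m+[n∸m]≡n c≤)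
  where
  Σa = sum (toList a)
  Σc = sum (toList c)
  len : r + length (toList c) ≡ r + j
  len = cong (_+_ r) (length-toList c)
  inner : ℕ → ℕ
  inner s = sum≤ t (λ D → δ (Σa + D) s * ⟦ stays D a b ⟧)
  helper : ∀ s → Σc + s ≡ t → ⟦ windows (r + j) t (suc r) (toList a List.++ (toList c List.++ toList b)) ⟧
                           ≡ sum≤ t (λ s → δ (Σc + s) t * inner s)
  helper s refl with Σa ≤? s
  ... | no Σa≰ = begin
    _        ≡⟨ cong ⟦_⟧ (windows-false r a (toList c) (toList b) len
                  (subst (_< Σa + Σc) (+-comm s Σc) (+-monoˡ-< Σc (≰⇒> Σa≰)))) ⟩
    0        ≡⟨ δ-sum≤-zero t Σa s (λ D → ⟦ stays D a b ⟧) (≰⇒> Σa≰) ⟨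
    inner s  ≡⟨ δ-sum≤ Σc s inner (m≤n+m s Σc) ⟨
    _        ∎
  ... | yes Σa≤ = begin
    _        ≡⟨ cong ⟦_⟧ (windows-stays (s ∸ Σa) a b (toList c) len total) ⟩
    ⟦ stays (s ∸ Σa) a b ⟧
             ≡⟨ δ-sum≤ Σa (s ∸ Σa) (λ D → ⟦ stays D a b ⟧) (≤-trans (m∸n≤m s Σa) (m≤n+m s Σc)) ⟨
    sum≤ t (λ D → δ (Σa + D) (Σa + (s ∸ Σa)) * ⟦ stays D a b ⟧)
             ≡⟨ cong inner (m+[n∸m]≡n Σa≤) ⟩
    inner s  ≡⟨ δ-sum≤ Σc s inner (m≤n+m s Σc) ⟨
    _        ∎
    where
    total : Σa + Σc + (s ∸ Σa) ≡ Σc + s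
    total = begin
      Σa + Σc + (s ∸ Σa)    ≡⟨ cong (_+ (s ∸ Σa)) (+-comm Σa Σc) ⟩
      Σc + Σa + (s ∸ Σa)    ≡⟨ +-assoc Σc Σa (s ∸ Σa) ⟩
      Σc + (Σa + (s ∸ Σa))  ≡⟨ cong (_+_ Σc) (m+[n∸m]≡n Σa≤) ⟩
      Σc + s              ∎

-- The Ehrhart count as iterated partial sums of a path count.

-- The bound D + w ≤ t makes the box harmless: each step satisfies a ≤ w and b ≤ D + a ≤ D + w, so
-- no path is cut off, and the bound passes to the remaining steps.
boxSum-pairs : ∀ t r D w → D + w ≤ t →
  boxSum t r (λ x → boxSum t r (λ y → δ (sum (toList x)) w * ⟦ stays D x y ⟧)) ≡ pairs r D w
boxSum-pairs t zero    D w _ = *-identityʳ _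
boxSum-pairs t (suc r) D w D+w≤t = sum≤-truncate (m+n≤o⇒n≤o D D+w≤t) hit miss
  where
  term : ℕ → ℕ → Vec ℕ r → Vec ℕ r → ℕ
  term a b x y = δ (a + sum (toList x)) w * ⟦ (b ≤ᵇ D + a) ∧ stays (D + a ∸ b) x y ⟧
  miss : ∀ a → w < a → boxSum t r (λ x → sum≤ t (λ b → boxSum t r (term a b x))) ≡ 0
  miss a w<a = boxSum-zero t r λ x → sum≤-zero t λ b → boxSum-zero t r λ y →
    cong (_* ⟦ (b ≤ᵇ D + a) ∧ stays (D + a ∸ b) x y ⟧) (δ-< (≤-trans w<a (m≤m+n a _)))
  hit : ∀ a → a ≤ w → boxSum t r (λ x → sum≤ t (λ b → boxSum t r (term a b x)))
                    ≡ sum≤ (D + a) (λ b → pairs r (D + a ∸ b) (w ∸ a))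
  hit a a≤w = trans (boxSum-sum≤-swap t r t _) (sum≤-truncate (≤-trans (+-monoʳ-≤ D a≤w) D+w≤t) hit-b miss-b)
    where
    total : D + a + (w ∸ a) ≡ D + w
    total = trans (+-assoc D a (w ∸ a)) (cong (_+_ D) (m+[n∸m]≡n a≤w))
    hit-b : ∀ b → b ≤ D + a → boxSum t r (λ x → boxSum t r (term a b x)) ≡ pairs r (D + a ∸ b) (w ∸ a)
    hit-b b b≤ = trans
      (boxSum-cong t r λ x → boxSum-cong t r λ y →
        cong₂ (λ p q → p * ⟦ q ∧ stays (D + a ∸ b) x y ⟧) (δ-∸ a _ a≤w) (≤ᵇ-true b≤))
      (boxSum-pairs t r (D + a ∸ b) (w ∸ a)
        (≤-trans (+-monoˡ-≤ (w ∸ a) (m∸n≤m (D + a) b)) (≤-trans (≤-reflexive total) D+w≤t)))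
    miss-b : ∀ b → D + a < b → boxSum t r (λ x → boxSum t r (term a b x)) ≡ 0
    miss-b b <b = boxSum-zero t r λ x → boxSum-zero t r λ y →
      trans (cong (λ q → δ (a + sum (toList x)) w * ⟦ q ∧ stays (D + a ∸ b) x y ⟧) (≤ᵇ-false <b)) (*-zeroʳ (δ (a + sum (toList x)) w))

-- Once the sum over `D` is outermost, its delta leaves Σa = s - D, and `boxSum-pairs` applies for
-- each starting gap.
boxSum-antidiag : ∀ t r s → s ≤ t →
  boxSum t r (λ x → boxSum t r (λ y → sum≤ t (λ D → δ (sum (toList x) + D) s * ⟦ stays D x y ⟧)))
  ≡ antidiag (pairs r) 0 s
boxSum-antidiag t r s s≤t = begin
  boxSum t r (λ x → boxSum t r (λ y → sum≤ t (λ D → term D x y)))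
    ≡⟨ boxSum-cong t r (λ x → boxSum-sum≤-swap t r t _) ⟩
  boxSum t r (λ x → sum≤ t (λ D → boxSum t r (term D x)))
    ≡⟨ boxSum-sum≤-swap t r t _ ⟩
  sum≤ t (λ D → boxSum t r (λ x → boxSum t r (term D x)))
    ≡⟨ sum≤-truncate s≤t hit miss ⟩
  antidiag (pairs r) 0 s ∎
  where
  term : ℕ → Vec ℕ r → Vec ℕ r → ℕ
  term D x y = δ (sum (toList x) + D) s * ⟦ stays D x y ⟧
  hit : ∀ D → D ≤ s → boxSum t r (λ x → boxSum t r (term D x)) ≡ pairs r D (s ∸ D)
  hit D D≤s = trans
    (boxSum-cong t r λ x → boxSum-cong t r λ y → cong (_* ⟦ stays D x y ⟧)
      (trans (cong (λ z → δ z s) (+-comm (sum (toList x)) D)) (δ-∸ D _ D≤s)))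
    (boxSum-pairs t r D (s ∸ D) (≤-trans (≤-reflexive (m+[n∸m]≡n D≤s)) s≤t))
  miss : ∀ D → s < D → boxSum t r (λ x → boxSum t r (term D x)) ≡ 0
  miss D s<D = boxSum-zero t r λ x → boxSum-zero t r λ y → cong (_* ⟦ stays D x y ⟧) (δ-< (≤-trans s<D (m≤n+m D (sum (toList x)))))

-- On generating functions this is multiplication by 1/(1-z).
partialSum : (ℕ → ℕ) → ℕ → ℕ
partialSum f u = sum≤ u (λ c → f (u ∸ c))

partialSum^ : ℕ → (ℕ → ℕ) → ℕ → ℕ
partialSum^ zero    f = f
partialSum^ (suc j) f = partialSum (partialSum^ j f)

-- Each coordinate of `c` lowers the available total independently of the others, which is one
-- partial sum.
boxSum-partialSum : ∀ t j u (f : ℕ → ℕ) → u ≤ t →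
  boxSum t j (λ c → sum≤ t (λ s → δ (sum (toList c) + s) u * f s)) ≡ partialSum^ j f u
boxSum-partialSum t zero    u f u≤t = δ-sum≤ 0 u f u≤t
boxSum-partialSum t (suc j) u f u≤t = sum≤-truncate u≤t
  (λ a a≤u → trans
    (boxSum-cong t j λ c → sum≤-cong t λ s _ → cong (_* f s)
      (trans (cong (λ z → δ z u) (+-assoc a (sum (toList c)) s)) (δ-∸ a _ a≤u)))
    (boxSum-partialSum t j (u ∸ a) f (≤-trans (m∸n≤m u a) u≤t)))
  (λ a u<a → boxSum-zero t j λ c → δ-sum≤-zero t (a + sum (toList c)) u f (≤-trans u<a (m≤m+n a (sum (toList c)))))

-- A point splits into blocks `a`, `c`, `b` of lengths r, j, r. With k = r + j there are r + 1
-- windows, and all of them contain `c`.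
ehrhart-partialSum : ∀ r j t → ehrhartBhat (r + j) (r + (j + r)) t ≡ partialSum^ j (antidiag (pairs r) 0) t
ehrhart-partialSum r j t = begin
  ehrhartBhat (r + j) (r + (j + r)) t
    ≡⟨ count-box t (r + (j + r)) _ ⟩
  boxSum t (r + (j + r)) (λ x → ⟦ inDilatedBhat (r + j) (r + (j + r)) t (toList x) ⟧)
    ≡⟨ boxSum-cong t (r + (j + r)) (λ x → cong ⟦_⟧ (trans
         (cong (λ m → all (λ i → sum (take (r + j) (drop i (toList x))) ≤ᵇ t) (upTo (suc m))) codim)
         (all-windows (r + j) t (suc r) (toList x) (toList x) (λ i → i) (λ _ → refl)))) ⟩
  boxSum t (r + (j + r)) (λ x → ⟦ windows (r + j) t (suc r) (toList x) ⟧)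
    ≡⟨ trans (boxSum-++ t r (j + r) _) (boxSum-cong t r λ a → boxSum-++ t j r _) ⟩
  boxSum t r (λ a → boxSum t j (λ c → boxSum t r (λ b → ⟦ windows (r + j) t (suc r) (toList (a ++ (c ++ b))) ⟧)))
    ≡⟨ boxSum-cong t r (λ a → boxSum-cong t j λ c → boxSum-cong t r λ b → trans
         (cong (λ z → ⟦ windows (r + j) t (suc r) z ⟧)
           (trans (toList-++ a (c ++ b)) (cong (toList a List.++_) (toList-++ c b))))
         (windows-convolution j t a c b)) ⟩
  boxSum t r (λ a → boxSum t j (λ c → boxSum t r (λ b → sum≤ t (λ s → δ (sum (toList c) + s) t * inner a b s))))
    -- With `c` outermost, the sums over `a` and `b` depend on it only through the delta in `s`.
    ≡⟨ boxSum-swap t r j _ ⟩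
  boxSum t j (λ c → boxSum t r (λ a → boxSum t r (λ b → sum≤ t (λ s → δ (sum (toList c) + s) t * inner a b s))))
    ≡⟨ boxSum-cong t j collect ⟩
  boxSum t j (λ c → sum≤ t (λ s → δ (sum (toList c) + s) t * antidiag (pairs r) 0 s))
    ≡⟨ boxSum-partialSum t j t (antidiag (pairs r) 0) ≤-refl ⟩
  partialSum^ j (antidiag (pairs r) 0) t ∎
  where
  codim : r + (j + r) ∸ (r + j) ≡ r
  codim = trans (cong (_∸ (r + j)) (sym (+-assoc r j r))) (m+n∸m≡n (r + j) r)
  inner : Vec ℕ r → Vec ℕ r → ℕ → ℕ
  inner a b s = sum≤ t (λ D → δ (sum (toList a) + D) s * ⟦ stays D a b ⟧)
  collect : ∀ (c : Vec ℕ j) →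
    boxSum t r (λ a → boxSum t r (λ b → sum≤ t (λ s → δ (sum (toList c) + s) t * inner a b s)))
    ≡ sum≤ t (λ s → δ (sum (toList c) + s) t * antidiag (pairs r) 0 s)
  collect c = begin
    boxSum t r (λ a → boxSum t r (λ b → sum≤ t (λ s → δ (Σc + s) t * inner a b s)))
      ≡⟨ boxSum-cong t r (λ a → boxSum-sum≤-swap t r t _) ⟩
    boxSum t r (λ a → sum≤ t (λ s → boxSum t r (λ b → δ (Σc + s) t * inner a b s)))
      ≡⟨ boxSum-sum≤-swap t r t _ ⟩
    sum≤ t (λ s → boxSum t r (λ a → boxSum t r (λ b → δ (Σc + s) t * inner a b s)))
      ≡⟨ sum≤-cong t (λ s s≤t → trans (boxSum-cong t r λ a → *-boxSum (δ (Σc + s) t) t r _)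
           (trans (*-boxSum (δ (Σc + s) t) t r _) (cong (δ (Σc + s) t *_) (boxSum-antidiag t r s s≤t)))) ⟩
    sum≤ t (λ s → δ (Σc + s) t * antidiag (pairs r) 0 s) ∎
    where Σc = sum (toList c)

-- The operators 1-z and z on power series.

shift : Series → Series
shift f zero    = + 0
shift f (suc t) = f t

times1-z-cong : ∀ {f g} → (∀ t → f t ≡ g t) → ∀ t → times1-z f t ≡ times1-z g t
times1-z-cong e zero    = e 0
times1-z-cong e (suc t) = cong₂ ℤ._-_ (e (suc t)) (e t)

times1-z^-cong : ∀ m {f g} → (∀ t → f t ≡ g t) → ∀ t → times1-z^ m f t ≡ times1-z^ m g t
times1-z^-cong zero    e = e
times1-z^-cong (suc m) e = times1-z-cong (times1-z^-cong m e)

-- Lets a factor 1-z act on the given series first, whereas `times1-z^` applies it last.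
times1-z^-comm : ∀ m f t → times1-z^ m (times1-z f) t ≡ times1-z^ (suc m) f t
times1-z^-comm zero    f t = refl
times1-z^-comm (suc m) f t = times1-z-cong (times1-z^-comm m f) t

times1-z-+ : ∀ f g t → times1-z (λ t → f t ℤ.+ g t) t ≡ times1-z f t ℤ.+ times1-z g t
times1-z-+ f g zero    = refl
times1-z-+ f g (suc t) = shuffle (f (suc t)) (g (suc t)) (f t) (g t)
  where
  shuffle : ∀ a b c d → (a ℤ.+ b) ℤ.- (c ℤ.+ d) ≡ (a ℤ.- c) ℤ.+ (b ℤ.- d)
  shuffle = ℤ-Solver.solve-∀

times1-z^-+ : ∀ m f g t → times1-z^ m (λ t → f t ℤ.+ g t) t ≡ times1-z^ m f t ℤ.+ times1-z^ m g t
times1-z^-+ zero    f g t = refl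
times1-z^-+ (suc m) f g t = trans (times1-z-cong (times1-z^-+ m f g) t) (times1-z-+ (times1-z^ m f) (times1-z^ m g) t)

times1-z-shift : ∀ f t → times1-z (shift f) t ≡ shift (times1-z f) t
times1-z-shift f zero          = refl
times1-z-shift f (suc zero)    = ℤ.+-identityʳ (f 0)
times1-z-shift f (suc (suc t)) = refl

times1-z^-shift : ∀ m f t → times1-z^ m (shift f) t ≡ shift (times1-z^ m f) t
times1-z^-shift zero    f t = refl
times1-z^-shift (suc m) f t = trans (times1-z-cong (times1-z^-shift m f) t) (times1-z-shift (times1-z^ m f) t)

times1-z^-zero : ∀ m t → times1-z^ m (λ _ → + 0) t ≡ + 0
times1-z^-zero zero    t       = refl
times1-z^-zero (suc m) zero    = times1-z^-zero m 0
times1-z^-zero (suc m) (suc t) = cong₂ ℤ._-_ (times1-z^-zero m (suc t)) (times1-z^-zero m t)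

-- Numerators of generating functions of binomial products.

-- The series of `H M` is (1-z)^(-M). The factor 1 is the value of `bin _ 0`, so that the case n = 0
-- of `HB₀` and `HB` has literally this form.
H-numerator : ∀ M d → times1-z^ M (λ y → + (H M y * 1)) d ≡ + δ d 0
H-numerator zero    zero    = refl
H-numerator zero    (suc d) = refl
H-numerator (suc M) d = trans (sym (times1-z^-comm M _ d)) (trans (times1-z^-cong M step d) (H-numerator M d))
  where
  shuffle : ∀ a b → (a ℤ.+ b) ℤ.- b ≡ a
  shuffle = ℤ-Solver.solve-∀
  step : ∀ y → times1-z (λ y → + (H (suc M) y * 1)) y ≡ + (H M y * 1)
  step zero    = cong (λ x → + (x * 1)) (sym (H-zeroʳ M))
  step (suc y) = begin
    + ((H M (suc y) + H (suc M) y) * 1) ℤ.- + (H (suc M) y * 1)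
      ≡⟨ cong (λ x → + x ℤ.- + (H (suc M) y * 1)) (*-distribʳ-+ 1 (H M (suc y)) (H (suc M) y)) ⟩
    + (H M (suc y) * 1 + H (suc M) y * 1) ℤ.- + (H (suc M) y * 1)
      ≡⟨ shuffle (+ (H M (suc y) * 1)) (+ (H (suc M) y * 1)) ⟩
    + (H M (suc y) * 1) ∎

HB₀ : ℕ → ℕ → Series
HB₀ M n y = + (H M y * bin y n)

-- The numerator is the single term H(M, n) z^n. By the product rule for differences, one factor 1-z
-- reduces the pair (M+1, n+1) to (M, n+1) and z times (M+1, n).
HB₀-numerator : ∀ M n d → times1-z^ (M + n) (HB₀ M n) d ≡ + (δ d n * H M n)
HB₀-numerator M zero d rewrite +-identityʳ M | H-zeroʳ M | *-identityʳ (δ d 0) = H-numerator M d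
HB₀-numerator zero (suc n) d = begin
  times1-z^ (suc n) (HB₀ 0 (suc n)) d    ≡⟨ times1-z^-cong (suc n) vanish d ⟩
  times1-z^ (suc n) (λ _ → + 0) d        ≡⟨ times1-z^-zero (suc n) d ⟩
  + 0                                    ≡⟨ cong +_ (*-zeroʳ (δ d (suc n))) ⟨
  + (δ d (suc n) * 0)                  ∎
  where
  vanish : ∀ y → HB₀ 0 (suc n) y ≡ + 0
  vanish zero    = refl
  vanish (suc y) = refl
HB₀-numerator (suc M) (suc n) d = begin
  times1-z^ (suc M + suc n) (HB₀ (suc M) (suc n)) d
    ≡⟨ times1-z^-comm (M + suc n) (HB₀ (suc M) (suc n)) d ⟨
  times1-z^ (M + suc n) (times1-z (HB₀ (suc M) (suc n))) d
    ≡⟨ times1-z^-cong (M + suc n) step d ⟩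
  times1-z^ (M + suc n) (λ y → HB₀ M (suc n) y ℤ.+ shift (HB₀ (suc M) n) y) d
    ≡⟨ times1-z^-+ (M + suc n) _ _ d ⟩
  times1-z^ (M + suc n) (HB₀ M (suc n)) d ℤ.+ times1-z^ (M + suc n) (shift (HB₀ (suc M) n)) d
    ≡⟨ cong₂ ℤ._+_ (HB₀-numerator M (suc n) d) (times1-z^-shift (M + suc n) (HB₀ (suc M) n) d) ⟩
  + (δ d (suc n) * H M (suc n)) ℤ.+ shift (times1-z^ (M + suc n) (HB₀ (suc M) n)) d
    ≡⟨ collect d ⟩
  + (δ d (suc n) * H (suc M) (suc n)) ∎
  where
  shuffle : ∀ h h′ b b′ → (h ℤ.+ h′) ℤ.* (b ℤ.+ b′) ℤ.- h′ ℤ.* b′ ≡ h ℤ.* (b ℤ.+ b′) ℤ.+ h′ ℤ.* b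
  shuffle = ℤ-Solver.solve-∀
  step : ∀ y → times1-z (HB₀ (suc M) (suc n)) y ≡ HB₀ M (suc n) y ℤ.+ shift (HB₀ (suc M) n) y
  step zero    = trans (cong +_ (trans (*-zeroʳ (H (suc M) 0)) (sym (*-zeroʳ (H M 0))))) (sym (ℤ.+-identityʳ _))
  step (suc y) = begin
    + ((h + h′) * (b + b′)) ℤ.- + (h′ * b′)
      ≡⟨ cong₂ ℤ._-_ (ℤ.pos-* (h + h′) (b + b′)) (ℤ.pos-* h′ b′) ⟩
    (+ h ℤ.+ + h′) ℤ.* (+ b ℤ.+ + b′) ℤ.- + h′ ℤ.* + b′
      ≡⟨ shuffle (+ h) (+ h′) (+ b) (+ b′) ⟩
    + h ℤ.* (+ b ℤ.+ + b′) ℤ.+ + h′ ℤ.* + b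
      ≡⟨ cong₂ ℤ._+_ (ℤ.pos-* h (b + b′)) (ℤ.pos-* h′ b) ⟨
    + (h * (b + b′)) ℤ.+ + (h′ * b) ∎
    where
    h = H M (suc y)
    h′ = H (suc M) y
    b = bin y n
    b′ = bin y (suc n)
  collect : ∀ d → + (δ d (suc n) * H M (suc n)) ℤ.+ shift (times1-z^ (M + suc n) (HB₀ (suc M) n)) d
                ≡ + (δ d (suc n) * H (suc M) (suc n))
  collect zero    = refl
  collect (suc d) = begin
    + (δ d n * H M (suc n)) ℤ.+ times1-z^ (M + suc n) (HB₀ (suc M) n) d
      ≡⟨ cong (λ m → + (δ d n * H M (suc n)) ℤ.+ times1-z^ m (HB₀ (suc M) n) d) (+-suc M n) ⟩
    + (δ d n * H M (suc n)) ℤ.+ times1-z^ (suc M + n) (HB₀ (suc M) n) d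
      ≡⟨ cong (ℤ._+_ (+ (δ d n * H M (suc n)))) (HB₀-numerator (suc M) n d) ⟩
    + (δ d n * H M (suc n) + δ d n * H (suc M) n)
      ≡⟨ cong +_ (*-distribˡ-+ (δ d n) (H M (suc n)) (H (suc M) n)) ⟨
    + (δ d n * H (suc M) (suc n)) ∎

bin∸-zero : ∀ p d → bin∸ p 0 d ≡ δ d 0
bin∸-zero p zero    = refl
bin∸-zero p (suc d) = refl

δ-bin : ∀ q d → δ d 0 * bin q d ≡ δ d 0
δ-bin q zero    = refl
δ-bin q (suc d) = refl

bin∸0 : ∀ n d → bin∸ 0 n d ≡ δ d n
bin∸0 zero    zero    = refl
bin∸0 zero    (suc d) = refl
bin∸0 (suc n) zero    = refl
bin∸0 (suc n) (suc d) = bin∸0 n d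

δ-subst : ∀ (f : ℕ → ℕ) d n → δ d n * f d ≡ δ d n * f n
δ-subst f zero    zero    = refl
δ-subst f zero    (suc n) = refl
δ-subst f (suc d) zero    = refl
δ-subst f (suc d) (suc n) = δ-subst (λ i → f (suc i)) d n

-- Extends `H-bin` to M = 0, where n = q + 1 and both sides vanish.
H-bin-pred : ∀ M n q → M + n ≡ suc q → H M n ≡ bin q n
H-bin-pred zero    (suc n) .n refl = sym (n<k⇒bin≡0 (n<1+n n))
H-bin-pred (suc M) n       q  e    = trans (H-bin M n) (cong (λ x → bin x n) (suc-injective e))

HB : ℕ → ℕ → ℕ → Series
HB M p n y = + (H M y * bin (y + p) n)

-- Induction on `p` by Pascal's rule in C(y+p+1, n+1). One summand keeps the exponent and trades a
-- unit of `p` for a unit of `q`; the other needs one factor 1-z fewer, so its numerator is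
-- multiplied by 1-z. At p = 0 only d = n survives.
HB-numerator : ∀ p q M n → M + n ≡ suc (p + q) → ∀ d →
               times1-z^ (M + n) (HB M p n) d ≡ + (bin∸ p n d * bin q d)
HB-numerator p q M zero e d rewrite +-identityʳ M =
  trans (H-numerator M d) (cong +_ (sym (trans (cong (_* bin q d) (bin∸-zero p d)) (δ-bin q d))))
HB-numerator zero q M n@(suc _) e d = begin
  times1-z^ (M + n) (HB M 0 n) d  ≡⟨ times1-z^-cong (M + n) (λ y → cong (λ x → + (H M y * bin x n)) (+-identityʳ y)) d ⟩
  times1-z^ (M + n) (HB₀ M n) d   ≡⟨ HB₀-numerator M n d ⟩
  + (δ d n * H M n)               ≡⟨ cong (λ x → + (δ d n * x)) (H-bin-pred M n q e) ⟩
  + (δ d n * bin q n)             ≡⟨ cong +_ (δ-subst (bin q) d n) ⟨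
  + (δ d n * bin q d)             ≡⟨ cong (λ x → + (x * bin q d)) (bin∸0 n d) ⟨
  + (bin∸ 0 n d * bin q d)        ∎
HB-numerator (suc p) q M (suc n) e d = begin
  times1-z^ (M + suc n) (HB M (suc p) (suc n)) d
    ≡⟨ times1-z^-cong (M + suc n) step d ⟩
  times1-z^ (M + suc n) (λ y → HB M p (suc n) y ℤ.+ HB M p n y) d
    ≡⟨ times1-z^-+ (M + suc n) (HB M p (suc n)) (HB M p n) d ⟩
  times1-z^ (M + suc n) (HB M p (suc n)) d ℤ.+ times1-z^ (M + suc n) (HB M p n) d
    ≡⟨ cong₂ ℤ._+_ (HB-numerator p (suc q) M (suc n) (trans e (cong suc (sym (+-suc p q)))) d)
                 (cong (λ m → times1-z^ m (HB M p n) d) (+-suc M n)) ⟩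
  + (bin∸ p (suc n) d * bin (suc q) d) ℤ.+ times1-z^ (suc (M + n)) (HB M p n) d
    ≡⟨ cong (ℤ._+_ (+ (bin∸ p (suc n) d * bin (suc q) d)))
            (times1-z-cong (HB-numerator p q M n (suc-injective (trans (sym (+-suc M n)) e))) d) ⟩
  + (bin∸ p (suc n) d * bin (suc q) d) ℤ.+ times1-z (λ d → + (bin∸ p n d * bin q d)) d
    ≡⟨ collect d ⟩
  + ((bin∸ p (suc n) d + bin∸ p n d) * bin q d)
    ≡⟨ cong (λ x → + (x * bin q d)) (bin∸-pascal p n d) ⟨
  + (bin∸ (suc p) (suc n) d * bin q d) ∎
  where
  step : ∀ y → HB M (suc p) (suc n) y ≡ HB M p (suc n) y ℤ.+ HB M p n y
  step y rewrite +-suc y p = cong +_ (trans (*-distribˡ-+ (H M y) (bin (y + p) n) (bin (y + p) (suc n)))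
                                              (+-comm (H M y * bin (y + p) n) _))
  shuffle : ∀ u v c c′ → u ℤ.* (c ℤ.+ c′) ℤ.+ (v ℤ.* c′ ℤ.- u ℤ.* c) ≡ (u ℤ.+ v) ℤ.* c′
  shuffle = ℤ-Solver.solve-∀
  collect : ∀ d → + (bin∸ p (suc n) d * bin (suc q) d) ℤ.+ times1-z (λ d → + (bin∸ p n d * bin q d)) d
                ≡ + ((bin∸ p (suc n) d + bin∸ p n d) * bin q d)
  collect zero    = cong +_ (sym (*-distribʳ-+ 1 (bin∸ p (suc n) 0) (bin∸ p n 0)))
  collect (suc d) = begin
    + (u * (c + c′)) ℤ.+ (+ (v * c′) ℤ.- + (u * c))
      ≡⟨ cong₂ ℤ._+_ (ℤ.pos-* u (c + c′)) (cong₂ ℤ._-_ (ℤ.pos-* v c′) (ℤ.pos-* u c)) ⟩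
    + u ℤ.* (+ c ℤ.+ + c′) ℤ.+ (+ v ℤ.* + c′ ℤ.- + u ℤ.* + c)
      ≡⟨ shuffle (+ u) (+ v) (+ c) (+ c′) ⟩
    (+ u ℤ.+ + v) ℤ.* + c′
      ≡⟨ ℤ.pos-* (u + v) c′ ⟨
    + ((u + v) * c′) ∎
    where
    u = bin∸ p n d
    v = bin∸ p n (suc d)
    c = bin q d
    c′ = bin q (suc d)

-- Assembling the Ehrhart h*-polynomial.

-- Applies `HB-numerator` to both products of `antidiag-det`: the free pairs give C(r, d)², the
-- crossing ones C(r, d-1) C(r, d+1). For r = 0 the path count is constantly 1.
antidiag-numerator : ∀ r d → times1-z^ (suc (r + r)) (λ s → + antidiag (pairs r) 0 s) d
                 ℤ.+ + (bin∸ r (suc r) d * bin r (suc d)) ≡ + (bin r d * bin r d)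
antidiag-numerator zero d = begin
  times1-z (λ s → + antidiag (pairs 0) 0 s) d ℤ.+ + (bin∸ 0 1 d * 0)
    ≡⟨ cong₂ (λ x y → x ℤ.+ + y) (times1-z-cong (λ s → cong +_ (trans (one s) (sym (cong (_* 1) (H-one s))))) d) (*-zeroʳ (bin∸ 0 1 d)) ⟩
  times1-z (λ s → + (H 1 s * 1)) d ℤ.+ + 0   ≡⟨ ℤ.+-identityʳ _ ⟩
  times1-z (λ s → + (H 1 s * 1)) d         ≡⟨ H-numerator 1 d ⟩
  + δ d 0                                    ≡⟨ cong +_ (last d) ⟩
  + (bin 0 d * bin 0 d)                    ∎
  where
  one : ∀ s → antidiag (pairs 0) 0 s ≡ 1
  one zero    = refl
  one (suc s) = one s
  last : ∀ d → δ d 0 ≡ bin 0 d * bin 0 d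
  last zero    = refl
  last (suc d) = refl
antidiag-numerator (suc r) d = begin
  times1-z^ K F d ℤ.+ + (bin∸ (suc r) (2 + r) d * bin (suc r) (suc d))
    ≡⟨ cong (ℤ._+_ (times1-z^ K F d)) crossing ⟨
  times1-z^ K F d ℤ.+ times1-z^ K X d
    ≡⟨ times1-z^-+ K F X d ⟨
  times1-z^ K (λ s → F s ℤ.+ X s) d
    ≡⟨ times1-z^-cong K (λ s → trans (cong +_ (antidiag-det r 0 s)) (free s)) d ⟩
  times1-z^ K (HB (2 + r) (suc r) (suc r)) d
    ≡⟨ HB-numerator (suc r) (suc r) (2 + r) (suc r) refl d ⟩
  + (bin∸ (suc r) (suc r) d * bin (suc r) d)
    ≡⟨ cong (λ x → + (x * bin (suc r) d)) (bin∸-diag (suc r) d) ⟩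
  + (bin (suc r) d * bin (suc r) d) ∎
  where
  K = suc (suc r + suc r)
  F X : Series
  F s = + antidiag (pairs (suc r)) 0 s
  X s = + (H s (3 + r) * H r (suc s))
  free : ∀ s → + (H (2 + r) s * H (2 + r) s) ≡ HB (2 + r) (suc r) (suc r) s
  free s = cong (λ x → + (H (2 + r) s * x)) (trans (H-sym (suc r) s) (H-bin s (suc r)))
  r+[3+r]≡K : r + (3 + r) ≡ K
  r+[3+r]≡K = begin
    r + suc (suc (suc r))    ≡⟨ +-suc r (2 + r) ⟩
    suc (r + suc (suc r))    ≡⟨ cong suc (+-suc r (suc r)) ⟩
    K                          ∎
  -- The crossing product involves s + 1, so it matches an `HB` series only after multiplication by
  -- z, and its coefficient is read off at d + 1. The new constant term is right because C(r+1, r+3)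
  -- = 0.
  crossing-shift : ∀ s → HB r (suc r) (3 + r) s ≡ shift X s
  crossing-shift zero    = cong +_ (trans (cong (H r 0 *_) (n<k⇒bin≡0 (m≤n⇒m≤1+n (n<1+n (suc r))))) (*-zeroʳ (H r 0)))
  crossing-shift (suc s) = cong +_ (trans (*-comm (H r (suc s)) _) (cong (_* H r (suc s))
    (sym (H-bin-pred s (3 + r) (suc s + suc r) (trans (+-suc s (2 + r)) (cong suc (+-suc s (suc r))))))))
  crossing : times1-z^ K X d ≡ + (bin∸ (suc r) (2 + r) d * bin (suc r) (suc d))
  crossing = begin
    times1-z^ K X d                                  ≡⟨ times1-z^-shift K X (suc d) ⟨
    times1-z^ K (shift X) (suc d)                    ≡⟨ times1-z^-cong K crossing-shift (suc d) ⟨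
    times1-z^ K (HB r (suc r) (3 + r)) (suc d)     ≡⟨ cong (λ m → times1-z^ m (HB r (suc r) (3 + r)) (suc d)) r+[3+r]≡K ⟨
    times1-z^ (r + (3 + r)) (HB r (suc r) (3 + r)) (suc d)
      ≡⟨ HB-numerator (suc r) (suc r) r (3 + r) r+[3+r]≡K (suc d) ⟩
    + (bin∸ (suc r) (2 + r) d * bin (suc r) (suc d)) ∎

-- Each partial sum is undone by one factor 1-z.
times1-z^-partialSum : ∀ j m f d → times1-z^ (j + m) (λ t → + partialSum^ j f t) d ≡ times1-z^ m (λ t → + f t) d
times1-z^-partialSum zero    m f d = refl
times1-z^-partialSum (suc j) m f d = begin
  times1-z^ (suc (j + m)) P d            ≡⟨ times1-z^-comm (j + m) P d ⟨
  times1-z^ (j + m) (times1-z P) d       ≡⟨ times1-z^-cong (j + m) difference d ⟩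
  times1-z^ (j + m) (λ t → + partialSum^ j f t) d  ≡⟨ times1-z^-partialSum j m f d ⟩
  times1-z^ m (λ t → + f t) d            ∎
  where
  P : Series
  P t = + partialSum^ (suc j) f t
  cancel : ∀ a b → (a ℤ.+ b) ℤ.- b ≡ a
  cancel = ℤ-Solver.solve-∀
  difference : ∀ t → times1-z P t ≡ + partialSum^ j f t
  difference zero    = refl
  difference (suc t) = cancel (+ partialSum^ j f (suc t)) (+ partialSum^ (suc j) f t)

-- By `narayana-det` the numerator of the Narayana number is (r+1)(X - Y), so the division is exact.
-- The same identity gives Y ≤ X, which makes the truncated difference a true one.
Qcoeff-det : ∀ r d → Qcoeff r d + bin∸ r (suc r) d * bin r (suc d) ≡ bin r d * bin r d
Qcoeff-det r d = begin
  Qcoeff r d + Y         ≡⟨ cong (_+ Y) quotient ⟩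
  (X ∸ Y) + Y            ≡⟨ m∸n+n≡m Y≤X ⟩
  X                      ∎
  where
  X = bin r d * bin r d
  Y = bin∸ r (suc r) d * bin r (suc d)
  N = bin (suc r) (suc d) * bin (suc r) d
  Y≤X : Y ≤ X
  Y≤X = *-cancelˡ-≤ (suc r) (≤-trans (m≤n+m (suc r * Y) N) (≤-reflexive (narayana-det r d)))
  N≡ : N ≡ (X ∸ Y) * suc r
  N≡ = begin
    N                          ≡⟨ m+n∸n≡m N (suc r * Y) ⟨
    N + suc r * Y ∸ suc r * Y  ≡⟨ cong (_∸ suc r * Y) (narayana-det r d) ⟩
    suc r * X ∸ suc r * Y      ≡⟨ *-distribˡ-∸ (suc r) X Y ⟨
    suc r * (X ∸ Y)            ≡⟨ *-comm (suc r) (X ∸ Y) ⟩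
    (X ∸ Y) * suc r            ∎
  quotient : Qcoeff r d ≡ X ∸ Y
  quotient = begin
    (suc r C suc d) * (suc r C d) / suc r  ≡⟨ cong (_/ suc r) (cong₂ _*_ (bin≡C (suc r) (suc d)) (bin≡C (suc r) d)) ⟨
    N / suc r                              ≡⟨ cong (_/ suc r) N≡ ⟩
    (X ∸ Y) * suc r / suc r                ≡⟨ m*n/n≡m (X ∸ Y) (suc r) ⟩
    X ∸ Y                                  ∎

hStar-Qcoeff : ∀ r j d → hStarBhat (r + j) (r + (j + r)) d ≡ + Qcoeff r d
-- Both sides are compared after adding the crossing term `Y`, the form in which both determinant
-- identities are available.
hStar-Qcoeff r j d = ∙-cancelʳ (AbelianGroup.group ℤ.+-0-abelianGroup) (+ Y) _ _ (begin
  hStarBhat (r + j) (r + (j + r)) d ℤ.+ + Y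
    ≡⟨ cong (ℤ._+ + Y) (times1-z^-cong (suc (r + (j + r))) (λ t → cong +_ (ehrhart-partialSum r j t)) d) ⟩
  times1-z^ (suc (r + (j + r))) (λ t → + partialSum^ j F t) d ℤ.+ + Y
    ≡⟨ cong (λ m → times1-z^ m (λ t → + partialSum^ j F t) d ℤ.+ + Y) (exponent r j) ⟩
  times1-z^ (j + suc (r + r)) (λ t → + partialSum^ j F t) d ℤ.+ + Y
    ≡⟨ cong (ℤ._+ + Y) (times1-z^-partialSum j (suc (r + r)) F d) ⟩
  times1-z^ (suc (r + r)) (λ t → + F t) d ℤ.+ + Y
    ≡⟨ antidiag-numerator r d ⟩
  + (bin r d * bin r d)
    ≡⟨ cong +_ (Qcoeff-det r d) ⟨
  + Qcoeff r d ℤ.+ + Y ∎)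
  where
  F = antidiag (pairs r) 0
  Y = bin∸ r (suc r) d * bin r (suc d)
  -- Of the n + 1 factors 1-z, `j` undo the middle coordinates and 2r + 1 act on the path count.
  exponent : ∀ r j → suc (r + (j + r)) ≡ j + suc (r + r)
  exponent = solve-∀

theorem2p12 : (k n : ℕ) → 1 ≤ k → k ≤ n → n ≤ 2 * k →
    (d : ℕ) → hStarBhat k n d ≡ + Qcoeff (n ∸ k) d
theorem2p12 k n _ k≤n n≤2k d = begin
  hStarBhat k n d                      ≡⟨ cong₂ (λ k n → hStarBhat k n d) k≡ n≡ ⟩
  hStarBhat (r + j) (r + (j + r)) d    ≡⟨ hStar-Qcoeff r j d ⟩
  + Qcoeff r d                         ∎
  where
  r = n ∸ k
  j = k ∸ r
  -- Here n ≤ 2k enters: it makes k = r + j for j = k - r, so that the windows share the `j` middle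
  -- coordinates.
  r≤k : r ≤ k
  r≤k = ≤-trans (∸-monoˡ-≤ k n≤2k) (≤-reflexive (trans (m+n∸m≡n k (k + 0)) (+-identityʳ k)))
  k≡ : k ≡ r + j
  k≡ = sym (m+[n∸m]≡n r≤k)
  n≡ : n ≡ r + (j + r)
  n≡ = begin
    n            ≡⟨ m+[n∸m]≡n k≤n ⟨
    k + r        ≡⟨ cong (_+ r) k≡ ⟩
    r + j + r    ≡⟨ +-assoc r j r ⟩
    r + (j + r)  ∎
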